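{- Let $G$ be a finite unweighted undirected graph with $n$ nodes. Let $H$ be the spanning subgraph of $G$ obtained as follows: start with all nodes of $G$ and no edges; for each node $x$ of $G$, add to $H$ exactly $\lfloor n^{1/3} \rfloor$ edges of $G$ incident to $x$ (chosen arbitrarily), or, if $\deg_G(x) < \lfloor n^{1/3} \rfloor$, add all edges of $G$ incident to $x$. Then apply $6$-spanner-completion to $H$. Regardless of the choices made (of initial edges, of violating pairs, and of shortest paths), the resulting graph $H$ has at most $O(n^{4/3})$ edges.
   Context: For a graph $F$ and nodes $u,v$, $d_F(u,v)$ denotes the length (number of edges) of a shortest path from $u$ to $v$ in $F$ ($\infty$ if none exists). A spanning subgraph $H$ of $G$ is an additive $k$-spanner of $G$ if $d_H(u,v) \le d_G(u,v)+k$ for every pair of nodes $u,v$. The procedure $k$-spanner-completion applied to a spanning subgraph $H$ of $G$ is: as long as there exists a pair of nodes $u,v$ with $d_H(u,v) > d_G(u,v)+k$, pick such a pair, find a shortest path from $u$ to $v$ in $G$, and add all edges of this path to $H$. When it terminates, $H$ is an additive $k$-spanner of $G$. The $O(\cdot)$ bound refers to an absolute constant independent of $G$ and $n$. -}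

module Defs where

open import Data.Empty using (⊥)
open import Data.Fin as Fin using (Fin)
open import Data.Fin.Subset using (Subset; _∈_; _∉_; _⊆_; ∣_∣)
open import Data.Fin.Subset.Properties using (_∈?_)
open import Data.List using (List; []; _∷_; length; filter; allFin; cartesianProduct)
open import Data.List.Relation.Unary.Unique.Propositional using (Unique)
open import Data.Nat using (ℕ; zero; suc; _+_; _^_; _≤_; _<_; _≤?_; z≤n; s≤s)
open import Data.Nat.Properties using (≰⇒>; ≤-<-trans; n<1+n; m≤n⇒m≤1+n; ^-monoˡ-<)
open import Data.Product using (Σ-syntax; ∃₂; _×_; _,_; proj₁; proj₂)
open import Data.Sum using (_⊎_)
open import Function.Bundles using (_⇔_)
open import Relation.Binary.Construct.Closure.ReflexiveTransitive using (Star; ε; _◅_)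
open import Relation.Binary.PropositionalEquality using (_≡_)
open import Relation.Nullary using (¬_; yes; no)
open import Relation.Nullary.Construct.Add.Supremum using (_⁺; [_]; ⊤⁺)
open import Relation.Nullary.Decidable using (_×-dec_)
import Relation.Binary.Construct.Add.Supremum.Strict as StrictSupremum

open StrictSupremum _<_ public using (_<⁺_)

record Graph (n : ℕ) : Set where
  field
    N      : Fin n → Subset n
    sym    : ∀ {u v} → v ∈ N u → u ∈ N v
    irrefl : ∀ {u} → u ∉ N u

  Adj : Fin n → Fin n → Set
  Adj u v = v ∈ N u

  deg : Fin n → ℕ
  deg u = ∣ N u ∣

  -- Each edge {u , v} is listed once, as the pair with u < v.
  edges : List (Fin n × Fin n)
  edges = filter (λ (u , v) → (u Fin.<? v) ×-dec (v ∈? N u))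
                 (cartesianProduct (allFin n) (allFin n))

  ∣E∣ : ℕ
  ∣E∣ = length edges

open Graph public using (N; Adj; deg; edges; ∣E∣)

module _ {n : ℕ} where

  Walk : Graph n → Fin n → Fin n → Set
  Walk F = Star (Adj F)

  vertices : ∀ {F : Graph n} {u v} → Walk F u v → List (Fin n)
  vertices {u = u} ε       = u ∷ []
  vertices {F} {u} (_ ◅ w) = u ∷ vertices {F} w

  walkLength : ∀ {F : Graph n} {u v} → Walk F u v → ℕ
  walkLength ε           = 0
  walkLength {F} (_ ◅ w) = suc (walkLength {F} w)

  -- a and b are joined by an edge of the walk, in either direction.
  WalkEdge : ∀ {F : Graph n} {u v} → Walk F u v → Fin n → Fin n → Set
  WalkEdge ε a b = ⊥
  WalkEdge {F} {u} (_◅_ {j = w} _ ws) a b =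
    (a ≡ u × b ≡ w) ⊎ (a ≡ w × b ≡ u) ⊎ WalkEdge {F} ws a b

  record Path (F : Graph n) (u v : Fin n) : Set where
    field
      walk   : Walk F u v
      simple : Unique (vertices {F} walk)

  pathLength : ∀ {F : Graph n} {u v} → Path F u v → ℕ
  pathLength {F} p = walkLength {F} (Path.walk p)

  PathEdge : ∀ {F : Graph n} {u v} → Path F u v → Fin n → Fin n → Set
  PathEdge {F} p = WalkEdge {F} (Path.walk p)

  IsShortest : ∀ {F : Graph n} {u v} → Path F u v → Set
  IsShortest {F} {u} {v} p = (q : Path F u v) → pathLength p ≤ pathLength q

  -- d_F(u , v) = d, for d in ℕ ∪ {∞}.
  IsDistance : Graph n → Fin n → Fin n → ℕ ⁺ → Set
  IsDistance F u v [ d ] = Σ[ p ∈ Path F u v ] (IsShortest p × pathLength p ≡ d)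
  IsDistance F u v ⊤⁺    = ¬ Path F u v

infixl 6 _+⁺_

_+⁺_ : ℕ ⁺ → ℕ → ℕ ⁺
[ d ] +⁺ k = [ d + k ]
⊤⁺    +⁺ k = ⊤⁺

module _ {n : ℕ} where

  -- d_H(u , v) > d_G(u , v) + k.
  Violating : ℕ → Graph n → Graph n → Fin n → Fin n → Set
  Violating k G H u v =
    ∃₂ λ dG dH → IsDistance G u v dG × IsDistance H u v dH × (dG +⁺ k) <⁺ dH

  record CompletionStep (k : ℕ) (G H H′ : Graph n) : Set where
    field
      {u v}     : Fin n
      violating : Violating k G H u v
      path      : Path G u v
      shortest  : IsShortest path
      added     : ∀ a b → Adj H′ a b ⇔ (Adj H a b ⊎ PathEdge path a b)

  -- H′ is the result of some terminated run of k-spanner-completion on H.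
  Completion : ℕ → Graph n → Graph n → Graph n → Set
  Completion k G H H′ =
    Star (CompletionStep k G) H H′ × (∀ u v → ¬ Violating k G H′ u v)

  -- An edge incident to x is represented by its other endpoint, so chosen x
  -- is the set of edges added at x.
  record Initial (r : ℕ) (G H : Graph n) : Set where
    field
      chosen   : Fin n → Subset n
      incident : ∀ x → chosen x ⊆ N G x
      exactly  : ∀ x → r ≤ deg G x → ∣ chosen x ∣ ≡ r
      all      : ∀ x → deg G x < r → chosen x ≡ N G x
      adjacent : ∀ x y → Adj H x y ⇔ (y ∈ chosen x ⊎ x ∈ chosen y)

⌊∛_⌋ : ℕ → ℕ
⌊∛ zero ⌋  = 0
⌊∛ suc n ⌋ with suc ⌊∛ n ⌋ ^ 3 ≤? suc n
... | yes _ = suc ⌊∛ n ⌋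
... | no  _ = ⌊∛ n ⌋

⌊∛⌋-spec : ∀ n → ⌊∛ n ⌋ ^ 3 ≤ n × n < suc ⌊∛ n ⌋ ^ 3
⌊∛⌋-spec zero = z≤n , s≤s z≤n
⌊∛⌋-spec (suc n) with suc ⌊∛ n ⌋ ^ 3 ≤? suc n
... | yes p = p , ≤-<-trans (proj₂ (⌊∛⌋-spec n)) (^-monoˡ-< 3 (n<1+n (suc ⌊∛ n ⌋)))
... | no ¬p = m≤n⇒m≤1+n (proj₁ (⌊∛⌋-spec n)) , ≰⇒> ¬p

module Submission where

-- Let A be the sum of the degrees of H, r = ⌊n^(1/3)⌋, and let Φ be the sum over ordered pairs of
-- max(0 , d_G − d_H + 5), so Φ ≤ 5n². A completion step adding t new edges raises A by at most 2t;
-- we show that it raises Φ by at least r²t/3, whence r²A + 6Φ₀ ≤ r²A₀ + 6Φ = O(n²) at the end.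
-- Every endpoint of a missing edge of G has at least r neighbours in H. Cut the added shortest path
-- down to the part from its first to its last new edge, with ends u and v and length l; still
-- d_H(u , v) > l + 6. If x is an H-neighbour of the vertex at position i, then d_H(u , x) > i + 3 or
-- d_H(x , v) > l − i + 3, and accordingly d(y , x) drops to at most d_G(y , x) + 4 for all
-- H-neighbours y of u, or of v. As the path is shortest, each x is adjacent to at most three of its
-- vertices, so at least rt/3 vertices x each gain r.

open import Defs
open import Data.Nat using (ℕ; _*_; _^_; _≤_)
open import Data.Product using (∃-syntax)
open import Data.Bool using (true; false; if_then_else_)
open import Data.Fin as Fin using (Fin; toℕ; fromℕ<)
open import Data.Fin.Properties using (any?; toℕ-fromℕ<; injective⇒≤)
open import Data.Fin.Subset using (Subset; _∈_; ∣_∣; inside; outside)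
open import Data.Fin.Subset.Properties using (_∈?_; p⊆q⇒∣p∣≤∣q∣)
open import Data.List as List using (List; length; filter; cartesianProduct)
import Data.List.Membership.Propositional as Listₘ
open import Data.List.Membership.Propositional.Properties using (∈-lookup)
open import Data.List.Properties using (filter-++; length-++; map-tabulate)
import Data.List.Relation.Unary.All as All
open import Data.List.Relation.Unary.All.Properties using (¬Any⇒All¬)
open import Data.List.Relation.Unary.AllPairs using ([]; _∷_)
open import Data.List.Relation.Unary.Any using (here; there)
open import Data.List.Relation.Unary.Unique.Propositional using (Unique)
open import Data.Nat using (zero; suc; _+_; _∸_; _<_; _≤?_; z≤n; s≤s; s≤s⁻¹; >-nonZero)
open import Data.Nat.Properties hiding (_≟_; _<?_)
open import Algebra.Properties.Semiring.Sum +-*-semiring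
  using (sum; sum-syntax; sum-cong-≗; sum-replicate-zero; ∑-distrib-+; ∑-comm; *-distribˡ-sum; *-distribʳ-sum)
open import Data.Nat.Tactic.RingSolver using (solve-∀)
open import Data.Product using (Σ-syntax; _×_; _,_; proj₁; proj₂)
open import Data.Sum using (_⊎_; inj₁; inj₂; [_,_]′)
open import Data.Vec using ([]; _∷_)
open import Function using (_∘_; case_of_)
open import Function.Bundles using (Equivalence; _⇔_)
open import Relation.Binary.Construct.Closure.ReflexiveTransitive using (Star; ε; _◅_)
open import Relation.Binary.Construct.Add.Supremum.Strict _<_ using ([<]-injective)
open import Relation.Binary.PropositionalEquality hiding ([_])
open import Relation.Nullary using (¬_; Dec; yes; no; does; contradiction)
open import Relation.Nullary.Construct.Add.Supremum using ([_]; ⊤⁺)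
open import Relation.Nullary.Decidable using (_×-dec_; ¬?)
open import Relation.Unary using (Decidable)

private
  variable
    n l m k i j r : ℕ
    P Q : Set

-- Indicators and finite sums

𝟙 : Dec P → ℕ
𝟙 d = if does d then 1 else 0

𝟙≤1 : (p? : Dec P) → 𝟙 p? ≤ 1
𝟙≤1 (yes _) = ≤-refl
𝟙≤1 (no _)  = z≤n

𝟙-true : (p? : Dec P) → P → 𝟙 p? ≡ 1
𝟙-true (yes _) _ = refl
𝟙-true (no ¬p) p = contradiction p ¬p

𝟙-false : (p? : Dec P) → ¬ P → 𝟙 p? ≡ 0
𝟙-false (yes p) ¬p = contradiction p ¬p
𝟙-false (no _)  _  = refl

𝟙-mono : (p? : Dec P) (q? : Dec Q) → (P → Q) → 𝟙 p? ≤ 𝟙 q?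
𝟙-mono (yes p) q? f = ≤-reflexive (sym (𝟙-true q? (f p)))
𝟙-mono (no _)  q? f = z≤n

𝟙-strict : (p? : Dec P) (q? : Dec Q) → ¬ P → Q → 𝟙 p? < 𝟙 q?
𝟙-strict p? q? ¬p q rewrite 𝟙-false p? ¬p | 𝟙-true q? q = ≤-refl

sum-mono : {f g : Fin n → ℕ} → (∀ x → f x ≤ g x) → sum f ≤ sum g
sum-mono {zero}  f≤g = z≤n
sum-mono {suc n} f≤g = +-mono-≤ (f≤g Fin.zero) (sum-mono (f≤g ∘ Fin.suc))

sum-strict : {f g : Fin n → ℕ} → (∀ x → f x ≤ g x) → ∀ x → f x < g x → sum f < sum g
sum-strict f≤g Fin.zero    lt = +-mono-<-≤ lt (sum-mono (f≤g ∘ Fin.suc))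
sum-strict f≤g (Fin.suc x) lt = +-mono-≤-< (f≤g Fin.zero) (sum-strict (f≤g ∘ Fin.suc) x lt)

sum≤n*c : (f : Fin n → ℕ) {c : ℕ} → (∀ x → f x ≤ c) → sum f ≤ n * c
sum≤n*c {zero}  f f≤c = z≤n
sum≤n*c {suc n} f f≤c = +-mono-≤ (f≤c Fin.zero) (sum≤n*c (f ∘ Fin.suc) (f≤c ∘ Fin.suc))

sum-𝟙≟* : (c : Fin n) (z : ℕ) → ∑[ x < n ] (𝟙 (x Fin.≟ c) * z) ≡ z
sum-𝟙≟* {suc n} Fin.zero z = begin
  z + 0 + ∑[ x < n ] 0      ≡⟨ cong₂ _+_ (+-identityʳ z) (sum-replicate-zero n) ⟩
  z + 0                     ≡⟨ +-identityʳ z ⟩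
  z                         ∎
  where open ≡-Reasoning
sum-𝟙≟* (Fin.suc c) z = sum-𝟙≟* c z

∣p∣≡sum : (p : Subset n) → ∣ p ∣ ≡ ∑[ x < n ] 𝟙 (x ∈? p)
∣p∣≡sum []            = refl
∣p∣≡sum (inside  ∷ p) = cong suc (∣p∣≡sum p)
∣p∣≡sum (outside ∷ p) = ∣p∣≡sum p

sum-mono-gain : (p : Subset n) {f g : Fin n → ℕ} → (∀ x → f x ≤ g x) →
                (∀ x → x ∈ p → f x < g x) → ∣ p ∣ + sum f ≤ sum g
sum-mono-gain {n} p {f} {g} f≤g f<g = begin
  ∣ p ∣ + sum f                     ≡⟨ cong (_+ sum f) (∣p∣≡sum p) ⟩
  ∑[ x < n ] 𝟙 (x ∈? p) + sum f     ≡⟨ ∑-distrib-+ (λ x → 𝟙 (x ∈? p)) f ⟨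
  ∑[ x < n ] (𝟙 (x ∈? p) + f x)     ≤⟨ sum-mono pointwise ⟩
  sum g                             ∎
  where
  open ≤-Reasoning
  pointwise : ∀ x → 𝟙 (x ∈? p) + f x ≤ g x
  pointwise x with x ∈? p
  ... | yes x∈p = f<g x x∈p
  ... | no  _   = f≤g x

-- Bounded search

least : {P : ℕ → Set} → Decidable P → ℕ → ℕ
least P? zero = 0
-- If no number up to `b` has the property, the search returns `b` itself as a default.
least P? (suc b) with P? (least P? b)
... | yes _ = least P? b
... | no  _ = suc b

least≤ : {P : ℕ → Set} (P? : Decidable P) (b : ℕ) → least P? b ≤ b
least≤ P? zero = z≤n
least≤ P? (suc b) with P? (least P? b)
... | yes _ = m≤n⇒m≤1+n (least≤ P? b)
... | no  _ = ≤-refl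

least-spec : {P : ℕ → Set} (P? : Decidable P) (b : ℕ) → m ≤ b → P m →
             P (least P? b) × least P? b ≤ m
least-spec P? zero z≤n p = p , z≤n
least-spec P? (suc b) m≤1+b p with P? (least P? b) | m≤n⇒m<n∨m≡n m≤1+b
... | yes q | inj₁ m≤b  = q , proj₂ (least-spec P? b (s≤s⁻¹ m≤b) p)
... | yes q | inj₂ refl = q , m≤n⇒m≤1+n (least≤ P? b)
... | no ¬q | inj₁ m≤b  = contradiction (proj₁ (least-spec P? b (s≤s⁻¹ m≤b) p)) ¬q
... | no ¬q | inj₂ refl = p , ≤-refl

-- Distances

infix 4 _⊑_

_⊑_ : Graph n → Graph n → Set
F ⊑ F′ = ∀ {a b} → Adj F a b → Adj F′ a b

-- d_F(a , b) ≤ m.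
data Within (F : Graph n) : ℕ → Fin n → Fin n → Set where
  here : ∀ {m a} → Within F m a a
  step : ∀ {m a b c} → Adj F a b → Within F m b c → Within F (suc m) a c

within? : (F : Graph n) → (m : ℕ) (a b : Fin n) → Dec (Within F m a b)
within? F m a b with a Fin.≟ b
... | yes refl = yes here
within? F zero a b | no a≢b = no λ { here → a≢b refl }
within? F (suc m) a b | no a≢b
  with any? (λ c → (c ∈? N F a) ×-dec within? F m c b)
... | yes (c , e , w) = yes (step e w)
... | no ¬∃ = no λ { here → a≢b refl ; (step e w) → ¬∃ (_ , e , w) }

module _ {n : ℕ} {F : Graph n} where

  private variable a b c u v : Fin n

  within-weaken : m ≤ k → Within F m a b → Within F k a b
  within-weaken m≤k       here       = here
  within-weaken (s≤s m≤k) (step e w) = step e (within-weaken m≤k w)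

  within-mono : {F′ : Graph n} → F ⊑ F′ → Within F m a b → Within F′ m a b
  within-mono F⊑F′ here       = here
  within-mono F⊑F′ (step e w) = step (F⊑F′ e) (within-mono F⊑F′ w)

  within-snoc : Within F m a b → Adj F b c → Within F (suc m) a c
  within-snoc here       e = step e here
  within-snoc (step f w) e = step f (within-snoc w e)

  within-sym : Within F m a b → Within F m b a
  within-sym here       = here
  within-sym (step e w) = within-snoc (within-sym w) (Graph.sym F e)

  within-trans : Within F m a b → Within F k b c → Within F (m + k) a c
  within-trans {m = m} here w′ = within-weaken (m≤n+m _ m) w′
  within-trans (step e w)   w′ = step e (within-trans w w′)

  walk-suffix : (w : Walk F c v) → Unique (vertices {F = F} w) →
                u Listₘ.∈ vertices {F = F} w →
                Σ[ w′ ∈ Walk F u v ] Unique (vertices {F = F} w′) ×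
                                     walkLength {F = F} w′ ≤ walkLength {F = F} w
  walk-suffix ε       uniq       (here refl) = ε , uniq , z≤n
  walk-suffix (e ◅ w) uniq       (here refl) = e ◅ w , uniq , ≤-refl
  walk-suffix (e ◅ w) (_ ∷ uniq) (there u∈w) =
    let w′ , uniq′ , le = walk-suffix w uniq u∈w in w′ , uniq′ , m≤n⇒m≤1+n le

  -- Loop erasure, needed because distances are defined by simple paths: if the new first vertex
  -- already lies on the path, only the part from its occurrence onwards is kept.
  within⇒path : Within F m u v → Σ[ p ∈ Path F u v ] pathLength p ≤ m
  within⇒path here = record { walk = ε ; simple = All.[] ∷ [] } , z≤n
  within⇒path {u = u} (step e w) with within⇒path w
  ... | p , le with u ∈ₗ? vertices {F = F} (Path.walk p)
    where open import Data.List.Membership.DecPropositional (Fin._≟_ {n}) renaming (_∈?_ to _∈ₗ?_)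
  ... | yes u∈p =
    let w′ , uniq , le′ = walk-suffix (Path.walk p) (Path.simple p) u∈p
    in record { walk = w′ ; simple = uniq } , m≤n⇒m≤1+n (≤-trans le′ le)
  ... | no u∉p =
    record { walk = e ◅ Path.walk p ; simple = ¬Any⇒All¬ _ u∉p ∷ Path.simple p } , s≤s le

  walk⇒within : (w : Walk F u v) → Within F (walkLength {F = F} w) u v
  walk⇒within ε       = here
  walk⇒within (e ◅ w) = step e (walk⇒within w)

  length-vertices : (w : Walk F u v) → length (vertices {F = F} w) ≡ suc (walkLength {F = F} w)
  length-vertices ε       = refl
  length-vertices (e ◅ w) = cong suc (length-vertices w)

lookup-injective : {xs : List (Fin n)} → Unique xs →
                   ∀ {i j} → List.lookup xs i ≡ List.lookup xs j → i ≡ j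
lookup-injective (_ ∷ _)     {Fin.zero}  {Fin.zero}  _  = refl
lookup-injective (x∉ ∷ _)    {Fin.zero}  {Fin.suc j} eq = contradiction eq (All.lookup x∉ (∈-lookup j))
lookup-injective (x∉ ∷ _)    {Fin.suc i} {Fin.zero}  eq = contradiction (sym eq) (All.lookup x∉ (∈-lookup i))
lookup-injective (_ ∷ uniq)  {Fin.suc i} {Fin.suc j} eq = cong Fin.suc (lookup-injective uniq eq)

-- Pigeonhole: a simple path has at most n vertices. Hence searching for distances up to n suffices.
within-n : {F : Graph n} {a b : Fin n} → Within F m a b → Within F n a b
within-n {n = n} {F = F} w = within-weaken bound (walk⇒within (Path.walk p))
  where
  p = proj₁ (within⇒path w)
  bound : pathLength p ≤ n
  bound = begin
    walkLength {F = F} (Path.walk p)          ≤⟨ n≤1+n _ ⟩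
    suc (walkLength {F = F} (Path.walk p))    ≡⟨ length-vertices (Path.walk p) ⟨
    length (vertices {F = F} (Path.walk p))   ≤⟨ injective⇒≤ (lookup-injective (Path.simple p)) ⟩
    n                                         ∎
    where open ≤-Reasoning

-- Walks of exact length and sums over their steps

-- Unlike `Within`, the index is the exact length, so that the position of a vertex on a shortest
-- path can be tracked as i + j = l.
data Route (F : Graph n) : ℕ → Fin n → Fin n → Set where
  nil  : ∀ {a} → Route F 0 a a
  cons : ∀ {l a b c} → Adj F a b → Route F l b c → Route F (suc l) a c

module _ {n : ℕ} {F : Graph n} where

  private variable u v : Fin n

  route⇒within : Route F l u v → Within F l u v
  route⇒within nil        = here
  route⇒within (cons e w) = step e (route⇒within w)

  -- A summand that ignores its second argument yields a sum over all vertices of the route but the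
  -- last.
  routeSum : (Fin n → Fin n → ℕ) → Route F l u v → ℕ
  routeSum f nil                    = 0
  routeSum f (cons {a = a} {b} _ w) = f a b + routeSum f w

  routeSum-cong : {f g : Fin n → Fin n → ℕ} → (∀ a b → f a b ≡ g a b) →
                  (w : Route F l u v) → routeSum f w ≡ routeSum g w
  routeSum-cong f≡g nil                    = refl
  routeSum-cong f≡g (cons {a = a} {b} _ w) = cong₂ _+_ (f≡g a b) (routeSum-cong f≡g w)

  routeSum-*ʳ : ∀ c (f : Fin n → Fin n → ℕ) (w : Route F l u v) →
                routeSum (λ a b → f a b * c) w ≡ routeSum f w * c
  routeSum-*ʳ c f nil        = refl
  routeSum-*ʳ c f (cons {a = a} {b} _ w) =
    trans (cong (f a b * c +_) (routeSum-*ʳ c f w)) (sym (*-distribʳ-+ c (f a b) _))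

  routeSum-sum : (f : Fin k → Fin n → Fin n → ℕ) (w : Route F l u v) →
                 routeSum (λ a b → ∑[ x < k ] f x a b) w ≡ ∑[ x < k ] routeSum (f x) w
  routeSum-sum {k = k} f nil = sym (sum-replicate-zero k)
  routeSum-sum f (cons {a = a} {b} _ w) =
    trans (cong (sum (λ x → f x a b) +_) (routeSum-sum f w))
          (sym (∑-distrib-+ (λ x → f x a b) (λ x → routeSum (f x) w)))

-- Potential gained by one completion step

module Potential {n : ℕ} (G : Graph n) where

  -- Meaningless when a and b are not connected in G.
  dist : Fin n → Fin n → ℕ
  dist a b = least (λ m → within? G m a b) n

  module _ {a b : Fin n} where

    within-dist : Within G m a b → Within G (dist a b) a b
    within-dist w = proj₁ (least-spec (λ m → within? G m a b) n ≤-refl (within-n w))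

    dist≤ : Within G m a b → dist a b ≤ m
    dist≤ {m} w with m ≤? n
    ... | yes m≤n = proj₂ (least-spec (λ m → within? G m a b) n m≤n w)
    -- The search never returns more than its bound n, so a larger `m` is harmless.
    ... | no  m≰n = ≤-trans (least≤ (λ m → within? G m a b) n) (<⇒≤ (≰⇒> m≰n))

  -- max(0 , d_G(a , b) − d_F(a , b) + 5), for a and b connected in G and F ⊑ G.
  value : Graph n → Fin n → Fin n → ℕ
  value F a b = ∑[ s < 5 ] 𝟙 (within? F (dist a b + toℕ s) a b)

  valueAt : Graph n → Fin n → ℕ
  valueAt F x = ∑[ y < n ] value F y x

  total : Graph n → ℕ
  total F = ∑[ x < n ] valueAt F x

  value≤5 : ∀ F a b → value F a b ≤ 5
  value≤5 F a b = sum≤n*c {5} _ {1} (λ s → 𝟙≤1 (within? F (dist a b + toℕ s) a b))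

  total≤ : ∀ F → total F ≤ n * (n * 5)
  total≤ F = sum≤n*c _ (λ x → sum≤n*c _ (λ y → value≤5 F y x))

new : Graph n → Fin n → Fin n → ℕ
new H a b = 𝟙 (¬? (b ∈? N H a))

module Gain {n r : ℕ} {G H H′ : Graph n} (H⊑H′ : H ⊑ H′) (H′⊑G : H′ ⊑ G)
            (rich : ∀ {a b} → Adj G a b → ¬ Adj H a b → r ≤ deg H a) where

  open Potential G

  private
    variable a b c u v x y : Fin n

    H⊑G : H ⊑ G
    H⊑G e = H′⊑G (H⊑H′ e)

  -- Only the lower bound d_G(u , v) ≥ l; a route of length l in a subgraph of G supplies the other
  -- half.
  Geodesic : ℕ → Fin n → Fin n → Set
  Geodesic l u v = ∀ {m} → Within G m u v → l ≤ m

  Geodesic-sym : Geodesic (i + j) u v → Geodesic (j + i) v u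
  Geodesic-sym {i} {j} geo w = ≤-trans (≤-reflexive (+-comm j i)) (geo (within-sym w))

  Geodesic-tail : Adj G a b → Geodesic (suc l) a v → Geodesic l b v
  Geodesic-tail e geo w = s≤s⁻¹ (geo (step e w))

  value-mono : ∀ a b → value H a b ≤ value H′ a b
  value-mono a b = sum-mono {5} λ s →
    𝟙-mono (within? H (dist a b + toℕ s) a b) (within? H′ _ a b) (within-mono H⊑H′)

  -- The threshold m lies in the window of the five slacks counted by `value`; the summand of slack
  -- m - d_G(a , b) switches from 0 to 1.
  value-strict : dist a b ≤ m → m ≤ 4 + dist a b →
                 ¬ Within H m a b → Within H′ m a b → value H a b < value H′ a b
  value-strict {a} {b} {m} d≤m m≤4+d far near = sum-strict {5}
    (λ s → 𝟙-mono (within? H (dist a b + toℕ s) a b) (within? H′ _ a b) (within-mono H⊑H′))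
    s (𝟙-strict (within? H _ a b) (within? H′ _ a b)
         (far ∘ subst (λ z → Within H z a b) eq) (subst (λ z → Within H′ z a b) (sym eq) near))
    where
    lt : m ∸ dist a b < 5
    lt = s≤s (m≤n+o⇒m∸n≤o m (dist a b) (≤-trans m≤4+d (≤-reflexive (+-comm 4 _))))
    s : Fin 5
    s = fromℕ< lt
    eq : dist a b + toℕ s ≡ m
    eq = trans (cong (dist a b +_) (toℕ-fromℕ< lt)) (m+[n∸m]≡n d≤m)

  valueAt-mono : ∀ x → valueAt H x ≤ valueAt H′ x
  valueAt-mono x = sum-mono (λ y → value-mono y x)

  -- The threshold is i + 2. In `H′` the way y, u, ..., a, x is that short; in `H` a way that short
  -- would put x within i + 3 of u. The detour u, y, ..., x, a, ..., v has length d_G(y , x) + 2 +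
  -- j, which is at least i + j, so i + 2 ≤ d_G(y , x) + 4 and the drop falls into the window of
  -- `value`.
  value-gain : Within H′ i u a → Within H′ j a v → Geodesic (i + j) u v →
               Adj H a x → ¬ Within H (3 + i) u x → Adj H u y → value H y x < value H′ y x
  value-gain {i} {u} {a} {j} {v} {x} {y} ua av geo ax far uy =
    value-strict (dist≤ yx) (+-cancelʳ-≤ j _ _ bound) (far ∘ step uy) near
    where
    near : Within H′ (2 + i) y x
    near = step (Graph.sym H′ (H⊑H′ uy)) (within-snoc ua (H⊑H′ ax))
    yx : Within G (2 + i) y x
    yx = within-mono H′⊑G near
    detour : Within G (suc (dist y x + suc j)) u v
    detour = step (H⊑G uy) (within-trans (within-dist yx)
               (step (Graph.sym G (H⊑G ax)) (within-mono H′⊑G av)))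
    bound : 2 + i + j ≤ 4 + dist y x + j
    bound = ≤-trans (+-monoʳ-≤ 2 (geo detour))
                    (≤-reflexive (cong (3 +_) (+-suc (dist y x) j)))

  -- x is far in H from u or from v, since d_H(u , v) exceeds i + j by more than 6.
  valueAt-gain : r ≤ deg H u → r ≤ deg H v → ¬ Within H (6 + (i + j)) u v →
                 Within H′ i u a → Within H′ j a v → Geodesic (i + j) u v →
                 Adj H a x → r + valueAt H x ≤ valueAt H′ x
  valueAt-gain {u} {v} {i} {j} {a} {x} ru rv far ua av geo ax with within? H (3 + i) u x
  ... | no ¬ux = ≤-trans (+-monoˡ-≤ _ ru) (sum-mono-gain (N H u) (λ y → value-mono y x)
                   (λ y → value-gain ua av geo ax ¬ux))
  ... | yes ux = ≤-trans (+-monoˡ-≤ _ rv) (sum-mono-gain (N H v) (λ y → value-mono y x)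
                   (λ y → value-gain (within-sym av) (within-sym ua) (Geodesic-sym {i} geo) ax ¬vx))
    where
    ¬vx : ¬ Within H (3 + j) v x
    ¬vx vx = far (subst (λ z → Within H z u v) (arith i j) (within-trans ux (within-sym vx)))
      where
      arith : ∀ i j → 3 + i + (3 + j) ≡ 6 + (i + j)
      arith = solve-∀

  visits : Fin n → Route H′ l u v → ℕ
  visits x = routeSum (λ a _ → 𝟙 (x ∈? N H a))

  -- From a counted vertex adjacent to x, the rest of the route would lead x to v in at most l + 1
  -- steps.
  far⇒unvisited : ∀ x (w : Route H′ l u v) → ¬ Within G (suc l) x v → visits x w ≡ 0
  far⇒unvisited x nil far = refl
  far⇒unvisited x (cons {a = a} e w) far with x ∈? N H a
  ... | yes ax = contradiction
                   (step (Graph.sym G (H⊑G ax)) (within-mono H′⊑G (step e (route⇒within w)))) far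
  ... | no  _  = far⇒unvisited x w (far ∘ within-weaken (n≤1+n _))

  visits-cons≤ : ∀ x (e : Adj H′ a b) (w : Route H′ l b v) → visits x w ≤ k →
                 visits x (cons e w) ≤ suc k
  visits-cons≤ {a = a} x e w le = +-mono-≤ (𝟙≤1 (x ∈? N H a)) le

  -- Let a be the first vertex adjacent to x. A neighbour of x three or more steps after a would
  -- allow a shortcut from a through x, of length 2 at the cost of at least 3. So only a and the
  -- next two vertices can count.
  visits≤3 : ∀ x (w : Route H′ l u v) → Geodesic l u v → visits x w ≤ 3
  visits≤3 x nil geo = z≤n
  visits≤3 x (cons {a = a} e w) geo with x ∈? N H a
  ... | no _ = visits≤3 x w (Geodesic-tail (H′⊑G e) geo)
  visits≤3 x (cons e nil) geo | yes _ = s≤s z≤n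
  visits≤3 x (cons e (cons f nil)) geo | yes _ = s≤s (visits-cons≤ x f nil z≤n)
  visits≤3 x (cons e (cons f (cons g w))) geo | yes ax =
    s≤s (visits-cons≤ x f (cons g w) (visits-cons≤ x g w
      (≤-reflexive (far⇒unvisited x w λ xv → <-irrefl refl (geo (step (H⊑G ax) xv))))))

  gain : Fin n → ℕ
  -- The truncation never acts, by `valueAt-mono`.
  gain x = valueAt H′ x ∸ valueAt H x

  sum-gain : sum gain + total H ≡ total H′
  sum-gain = trans (sym (∑-distrib-+ gain (valueAt H)))
                   (sum-cong-≗ (λ x → m∸n+n≡m (valueAt-mono x)))

  neighbourGain : Fin n → ℕ
  neighbourGain a = ∑[ x < n ] (𝟙 (x ∈? N H a) * gain x)

  neighbourGain≥ : r ≤ deg H a → (∀ {x} → Adj H a x → r ≤ gain x) → r * r ≤ neighbourGain a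
  neighbourGain≥ {a} ra r≤gain = begin
    r * r                                ≤⟨ *-monoˡ-≤ r ra ⟩
    deg H a * r                          ≡⟨ cong (_* r) (∣p∣≡sum (N H a)) ⟩
    sum (λ x → 𝟙 (x ∈? N H a)) * r       ≡⟨ *-distribʳ-sum r (λ x → 𝟙 (x ∈? N H a)) ⟩
    ∑[ x < n ] (𝟙 (x ∈? N H a) * r)      ≤⟨ sum-mono pointwise ⟩
    neighbourGain a                      ∎
    where
    open ≤-Reasoning
    pointwise : ∀ x → 𝟙 (x ∈? N H a) * r ≤ 𝟙 (x ∈? N H a) * gain x
    pointwise x with x ∈? N H a
    ... | yes ax = *-monoʳ-≤ 1 (r≤gain ax)
    ... | no  _  = z≤n

  -- Double counting: after exchanging the sums, `gain x` is taken once per visit to a neighbour of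
  -- x, at most three times.
  neighbourGains≤ : (w : Route H′ l u v) → Geodesic l u v →
                    routeSum (λ a _ → neighbourGain a) w ≤ 3 * sum gain
  neighbourGains≤ w geo = begin
    routeSum (λ a _ → neighbourGain a) w
      ≡⟨ routeSum-sum (λ x a _ → 𝟙 (x ∈? N H a) * gain x) w ⟩
    ∑[ x < n ] routeSum (λ a _ → 𝟙 (x ∈? N H a) * gain x) w
      ≡⟨ sum-cong-≗ (λ x → routeSum-*ʳ (gain x) (λ a _ → 𝟙 (x ∈? N H a)) w) ⟩
    ∑[ x < n ] (visits x w * gain x)
      ≤⟨ sum-mono (λ x → *-monoˡ-≤ (gain x) (visits≤3 x w geo)) ⟩
    ∑[ x < n ] (3 * gain x)
      ≡⟨ *-distribˡ-sum 3 gain ⟨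
    3 * sum gain ∎
    where open ≤-Reasoning

  newSteps : Route H′ l u v → ℕ
  newSteps = routeSum (new H)

  -- Induction along the route with its ends u and v kept fixed: a is the current vertex at position
  -- i, and `ua` records the part already traversed. If the step out of a is new, then a is rich,
  -- and its neighbours pay r² for the step.
  newSteps≤neighbourGains :
    r ≤ deg H u → r ≤ deg H v → ¬ Within H (6 + l) u v → Geodesic l u v →
    Within H′ i u a → (w : Route H′ j a v) → i + j ≡ l →
    r * r * newSteps w ≤ routeSum (λ a _ → neighbourGain a) w
  newSteps≤neighbourGains ru rv far geo ua nil eq = ≤-reflexive (*-zeroʳ (r * r))
  newSteps≤neighbourGains {i = i} ru rv far geo ua (cons {l = j} {a = a} {b} e w) refl = begin
    r * r * (new H a b + newSteps w)         ≡⟨ *-distribˡ-+ (r * r) (new H a b) _ ⟩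
    r * r * new H a b + r * r * newSteps w   ≤⟨ +-mono-≤ first rest ⟩
    neighbourGain a + routeSum (λ a _ → neighbourGain a) w  ∎
    where
    open ≤-Reasoning
    rest = newSteps≤neighbourGains ru rv far geo (within-snoc ua e) w (sym (+-suc i j))
    first : r * r * new H a b ≤ neighbourGain a
    first with b ∈? N H a
    ... | yes _ = ≤-trans (≤-reflexive (*-zeroʳ (r * r))) z≤n
    ... | no ¬ab = ≤-trans (≤-reflexive (*-identityʳ (r * r)))
      (neighbourGain≥ (rich (H′⊑G e) ¬ab) λ ax → m+n≤o⇒m≤o∸n r
        (valueAt-gain {i = i} ru rv far ua (step e (route⇒within w)) geo ax))

  newSteps≤gain-rich :
    r ≤ deg H u → r ≤ deg H v → (w : Route H′ l u v) → ¬ Within H (6 + l) u v →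
    Geodesic l u v → r * r * newSteps w ≤ 3 * sum gain
  newSteps≤gain-rich ru rv w far geo =
    ≤-trans (newSteps≤neighbourGains {i = 0} ru rv far geo here w refl) (neighbourGains≤ w geo)

  newSteps-old : (e : Adj H′ a b) (w : Route H′ l b v) → Adj H a b →
                 newSteps (cons e w) ≡ newSteps w
  newSteps-old {a} {b} e w ab =
    cong (_+ newSteps w) (𝟙-false (¬? (b ∈? N H a)) (λ ¬ab → ¬ab ab))

  -- Cuts off the old steps after the last new one.
  trimEnd : (w : Route H′ l u v) →
            (newSteps w ≡ 0 × Within H l u v) ⊎
            (∃[ c ] ∃[ i ] ∃[ j ] i + j ≡ l × r ≤ deg H c × Within H j c v ×
             Σ[ w′ ∈ Route H′ i u c ] newSteps w′ ≡ newSteps w)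
  trimEnd nil = inj₁ (refl , here)
  trimEnd {l = suc l} (cons {a = a} {b} e w) with trimEnd w
  ... | inj₂ (c , i , j , eq , rc , cv , w′ , eq′) =
    inj₂ (c , suc i , j , cong suc eq , rc , cv , cons e w′ , cong (new H a b +_) eq′)
  ... | inj₁ (eq , bv) with b ∈? N H a in eq?
  ...   | yes ab = inj₁ (eq , step ab bv)
  -- This is the last new step. Its head `b` is an endpoint of a missing edge as well, hence rich.
  ...   | no ¬ab = inj₂ (b , 1 , l , refl , rich (Graph.sym G (H′⊑G e)) (¬ab ∘ Graph.sym H) , bv ,
                         cons e nil , trans (cong (λ d → 𝟙 (¬? d) + 0) eq?) (cong suc (sym eq)))

  -- Strips old steps from the front until the first new one. A stripped step lies in `H`, so it
  -- lowers the length and the bound on the distance in `H` by one each, and the excess of 6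
  -- survives.
  newSteps≤gain-richEnd :
    r ≤ deg H v → (w : Route H′ l u v) → ¬ Within H (6 + l) u v →
    Geodesic l u v → r * r * newSteps w ≤ 3 * sum gain
  newSteps≤gain-richEnd rv nil far geo = ≤-trans (≤-reflexive (*-zeroʳ (r * r))) z≤n
  newSteps≤gain-richEnd rv (cons {a = a} {b} e w) far geo = case b ∈? N H a of λ where
    (no ¬ab) → newSteps≤gain-rich (rich (H′⊑G e) ¬ab) rv (cons e w) far geo
    (yes ab) → subst (λ z → r * r * z ≤ 3 * sum gain) (sym (newSteps-old e w ab))
      (newSteps≤gain-richEnd rv w (far ∘ step ab) (Geodesic-tail (H′⊑G e) geo))

  newSteps≤gain : (w : Route H′ l u v) → ¬ Within H (6 + l) u v →
                  Geodesic l u v → r * r * newSteps w ≤ 3 * sum gain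
  newSteps≤gain {u = u} {v = v} w far geo with trimEnd w
  ... | inj₁ (eq , _) = ≤-trans (≤-reflexive (trans (cong (r * r *_) eq) (*-zeroʳ (r * r)))) z≤n
  ... | inj₂ (c , i , j , refl , rc , cv , w′ , eq) = subst (λ z → r * r * z ≤ 3 * sum gain) eq
    (newSteps≤gain-richEnd rc w′
      -- The removed tail of length j lies in `H`: both a short way from u to c in `H` and a
      -- shortcut in G would extend along it to v.
      (λ uc → far (within-trans uc cv))
      (λ {m} uc → +-cancelʳ-≤ j i m (geo (within-trans uc (within-mono H⊑G cv)))))

-- Edge counts

degSum : Graph n → ℕ
degSum {n} F = ∑[ a < n ] deg F a

degSum≡ : (F : Graph n) → degSum F ≡ ∑[ a < n ] ∑[ b < n ] 𝟙 (b ∈? N F a)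
degSum≡ F = sum-cong-≗ (λ a → ∣p∣≡sum (N F a))

length-filter-tabulate : {A : Set} {P : A → Set} (P? : Decidable P) (f : Fin n → A) →
                         length (filter P? (List.tabulate f)) ≡ ∑[ x < n ] 𝟙 (P? (f x))
length-filter-tabulate {zero}  P? f = refl
length-filter-tabulate {suc n} P? f with does (P? (f Fin.zero))
... | true  = cong suc (length-filter-tabulate P? (f ∘ Fin.suc))
... | false = length-filter-tabulate P? (f ∘ Fin.suc)

length-filter-cartesianProduct :
  {A B : Set} {P : A × B → Set} (P? : Decidable P) (f : Fin m → A) (g : Fin n → B) →
  length (filter P? (cartesianProduct (List.tabulate f) (List.tabulate g)))
    ≡ ∑[ x < m ] ∑[ y < n ] 𝟙 (P? (f x , g y))
length-filter-cartesianProduct {zero}  P? f g = refl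
length-filter-cartesianProduct {suc m} {n} P? f g = begin
  length (filter P? (row List.++ rest))
    ≡⟨ cong length (filter-++ P? row rest) ⟩
  length (filter P? row List.++ filter P? rest)
    ≡⟨ length-++ (filter P? row) ⟩
  length (filter P? row) + length (filter P? rest)
    ≡⟨ cong₂ _+_ (cong (length ∘ filter P?) (map-tabulate g (f Fin.zero ,_)))
                 (length-filter-cartesianProduct P? (f ∘ Fin.suc) g) ⟩
  length (filter P? (List.tabulate (λ y → f Fin.zero , g y))) + _
    ≡⟨ cong (_+ _) (length-filter-tabulate P? (λ y → f Fin.zero , g y)) ⟩
  ∑[ x < suc m ] ∑[ y < n ] 𝟙 (P? (f x , g y)) ∎
  where
  open ≡-Reasoning
  row  = List.map (f Fin.zero ,_) (List.tabulate g)
  rest = cartesianProduct (List.tabulate (f ∘ Fin.suc)) (List.tabulate g)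

-- Dropping the condition u < v counts each edge twice, which costs only a constant factor.
∣E∣≤degSum : (F : Graph n) → ∣E∣ F ≤ degSum F
∣E∣≤degSum {n} F = begin
  ∣E∣ F
    ≡⟨ length-filter-cartesianProduct (λ (u , v) → (u Fin.<? v) ×-dec (v ∈? N F u)) (λ x → x) (λ x → x) ⟩
  ∑[ a < n ] ∑[ b < n ] 𝟙 ((a Fin.<? b) ×-dec (b ∈? N F a))
    ≤⟨ sum-mono (λ a → sum-mono (λ b → 𝟙-mono ((a Fin.<? b) ×-dec (b ∈? N F a)) (b ∈? N F a) proj₂)) ⟩
  ∑[ a < n ] ∑[ b < n ] 𝟙 (b ∈? N F a)
    ≡⟨ degSum≡ F ⟨
  degSum F ∎
  where open ≤-Reasoning

-- For distinct c and d this is the indicator of {a , b} = {c , d}, written with products so that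
-- the sums over b and then a collapse.
joins : (a b c d : Fin n) → ℕ
joins a b c d = 𝟙 (b Fin.≟ d) * 𝟙 (a Fin.≟ c) + 𝟙 (b Fin.≟ c) * 𝟙 (a Fin.≟ d)

sum-𝟙≟ : (c : Fin n) → ∑[ x < n ] 𝟙 (x Fin.≟ c) ≡ 1
sum-𝟙≟ c = trans (sum-cong-≗ (λ x → sym (*-identityʳ (𝟙 (x Fin.≟ c))))) (sum-𝟙≟* c 1)

sum-joins : (c d : Fin n) → ∑[ a < n ] ∑[ b < n ] joins a b c d ≡ 2
sum-joins {n} c d = begin
  ∑[ a < n ] ∑[ b < n ] joins a b c d
    ≡⟨ sum-cong-≗ (λ a → ∑-distrib-+ (λ b → 𝟙 (b Fin.≟ d) * 𝟙 (a Fin.≟ c))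
                                     (λ b → 𝟙 (b Fin.≟ c) * 𝟙 (a Fin.≟ d))) ⟩
  ∑[ a < n ] (∑[ b < n ] (𝟙 (b Fin.≟ d) * 𝟙 (a Fin.≟ c)) + ∑[ b < n ] (𝟙 (b Fin.≟ c) * 𝟙 (a Fin.≟ d)))
    ≡⟨ sum-cong-≗ (λ a → cong₂ _+_ (sum-𝟙≟* d (𝟙 (a Fin.≟ c))) (sum-𝟙≟* c (𝟙 (a Fin.≟ d)))) ⟩
  ∑[ a < n ] (𝟙 (a Fin.≟ c) + 𝟙 (a Fin.≟ d))
    ≡⟨ ∑-distrib-+ (λ a → 𝟙 (a Fin.≟ c)) (λ a → 𝟙 (a Fin.≟ d)) ⟩
  ∑[ a < n ] 𝟙 (a Fin.≟ c) + ∑[ a < n ] 𝟙 (a Fin.≟ d)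
    ≡⟨ cong₂ _+_ (sum-𝟙≟ c) (sum-𝟙≟ d) ⟩
  2 ∎
  where open ≡-Reasoning

-- Completion steps

module _ {n : ℕ} {G : Graph n} where

  private variable u v : Fin n

  walk⇒route : {F : Graph n} (w : Walk G u v) → (∀ {a b} → WalkEdge {F = G} w a b → Adj F a b) →
               Route F (walkLength {F = G} w) u v
  walk⇒route ε       f = nil
  walk⇒route (e ◅ w) f = cons (f (inj₁ (refl , refl))) (walk⇒route w (f ∘ inj₂ ∘ inj₂))

  walkEdge⇒adj : (w : Walk G u v) → ∀ {a b} → WalkEdge {F = G} w a b → Adj G a b
  walkEdge⇒adj (e ◅ w) (inj₁ (refl , refl))        = e
  walkEdge⇒adj (e ◅ w) (inj₂ (inj₁ (refl , refl))) = Graph.sym G e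
  walkEdge⇒adj (e ◅ w) (inj₂ (inj₂ we))            = walkEdge⇒adj w we

module _ {n : ℕ} {G H H′ : Graph n} {u v : Fin n} (w : Walk G u v)
         (added : ∀ a b → Adj H′ a b ⇔ (Adj H a b ⊎ WalkEdge {F = G} w a b)) where

  private
    newJoins : Fin n → Fin n → Fin n → Fin n → ℕ
    newJoins a b c d = new H c d * joins a b c d

    route : Route H′ (walkLength {F = G} w) u v
    route = walk⇒route w (λ we → Equivalence.from (added _ _) (inj₂ we))

  -- Every adjacency that `H′` has beyond `H` is charged to some new step of the route; the two
  -- orientations of the step match the two terms of `joins`.
  newEdge-counted : ∀ {x y a b} (w : Walk G x y)
                    (f : ∀ {a b} → WalkEdge {F = G} w a b → Adj H′ a b) →
                    WalkEdge {F = G} w a b → ¬ Adj H a b →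
                    1 ≤ routeSum (newJoins a b) (walk⇒route {F = H′} w f)
  newEdge-counted {a = a} {b} (_◅_ {i = c} {j = d} e w) f (inj₁ (refl , refl)) ¬ab =
    m≤n⇒m≤n+o _ (*-mono-≤ (≤-reflexive (sym (𝟙-true (¬? (d ∈? N H c)) ¬ab)))
      (m≤n⇒m≤n+o _ (*-mono-≤ (≤-reflexive (sym (𝟙-true (b Fin.≟ b) refl)))
                             (≤-reflexive (sym (𝟙-true (a Fin.≟ a) refl))))))
  newEdge-counted {a = a} {b} (_◅_ {i = c} {j = d} e w) f (inj₂ (inj₁ (refl , refl))) ¬ab =
    m≤n⇒m≤n+o _ (*-mono-≤ (≤-reflexive (sym (𝟙-true (¬? (d ∈? N H c)) (¬ab ∘ Graph.sym H))))
      (m≤n⇒m≤o+n _ (*-mono-≤ (≤-reflexive (sym (𝟙-true (b Fin.≟ b) refl)))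
                             (≤-reflexive (sym (𝟙-true (a Fin.≟ a) refl))))))
  newEdge-counted (e ◅ w) f (inj₂ (inj₂ we)) ¬ab =
    m≤n⇒m≤o+n _ (newEdge-counted w (f ∘ inj₂ ∘ inj₂) we ¬ab)

  -- Exchanging the sums, each new step is charged by exactly two ordered pairs, its two
  -- orientations.
  degSum-step : degSum H′ ≤ degSum H + routeSum (new H) route * 2
  degSum-step = begin
    degSum H′
      ≡⟨ degSum≡ H′ ⟩
    ∑[ a < n ] ∑[ b < n ] 𝟙 (b ∈? N H′ a)
      ≤⟨ sum-mono (λ a → sum-mono (λ b → pointwise a b)) ⟩
    ∑[ a < n ] ∑[ b < n ] (𝟙 (b ∈? N H a) + extra a b)
      ≡⟨ sum-cong-≗ (λ a → ∑-distrib-+ (λ b → 𝟙 (b ∈? N H a)) (extra a)) ⟩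
    ∑[ a < n ] (∑[ b < n ] 𝟙 (b ∈? N H a) + ∑[ b < n ] extra a b)
      ≡⟨ ∑-distrib-+ (λ a → ∑[ b < n ] 𝟙 (b ∈? N H a)) (λ a → ∑[ b < n ] extra a b) ⟩
    ∑[ a < n ] ∑[ b < n ] 𝟙 (b ∈? N H a) + ∑[ a < n ] ∑[ b < n ] extra a b
      ≡⟨ cong₂ _+_ (sym (degSum≡ H)) extra-total ⟩
    degSum H + routeSum (new H) route * 2 ∎
    where
    extra : Fin n → Fin n → ℕ
    extra a b = routeSum (newJoins a b) route

    pointwise : ∀ a b → 𝟙 (b ∈? N H′ a) ≤ 𝟙 (b ∈? N H a) + extra a b
    pointwise a b with b ∈? N H′ a
    ... | no _ = z≤n
    ... | yes ab′ with b ∈? N H a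
    ...   | yes _ = s≤s z≤n
    ...   | no ¬ab = [ (λ ab → contradiction ab ¬ab) , (λ we → newEdge-counted w _ we ¬ab) ]′
                       (Equivalence.to (added a b) ab′)

    open ≤-Reasoning

    joins-total : ∀ c d → ∑[ a < n ] ∑[ b < n ] newJoins a b c d ≡ new H c d * 2
    joins-total c d = begin-equality
      ∑[ a < n ] ∑[ b < n ] (new H c d * joins a b c d)
        ≡⟨ sum-cong-≗ (λ a → *-distribˡ-sum (new H c d) (λ b → joins a b c d)) ⟨
      ∑[ a < n ] (new H c d * ∑[ b < n ] joins a b c d)
        ≡⟨ *-distribˡ-sum (new H c d) (λ a → ∑[ b < n ] joins a b c d) ⟨
      new H c d * ∑[ a < n ] ∑[ b < n ] joins a b c d
        ≡⟨ cong (new H c d *_) (sum-joins c d) ⟩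
      new H c d * 2 ∎

    extra-total : ∑[ a < n ] ∑[ b < n ] extra a b ≡ routeSum (new H) route * 2
    extra-total = begin-equality
      ∑[ a < n ] ∑[ b < n ] extra a b
        ≡⟨ sum-cong-≗ (λ a → routeSum-sum (newJoins a) route) ⟨
      ∑[ a < n ] routeSum (λ c d → ∑[ b < n ] newJoins a b c d) route
        ≡⟨ routeSum-sum (λ a c d → ∑[ b < n ] newJoins a b c d) route ⟨
      routeSum (λ c d → ∑[ a < n ] ∑[ b < n ] newJoins a b c d) route
        ≡⟨ routeSum-cong joins-total route ⟩
      routeSum (λ c d → new H c d * 2) route
        ≡⟨ routeSum-*ʳ 2 (new H) route ⟩
      routeSum (new H) route * 2 ∎

-- Amortized analysis of a run

module _ {n r : ℕ} (G : Graph n) where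

  open Potential G

  -- The invariant of the run. Richness persists because adding edges leaves fewer edges missing and
  -- only raises degrees.
  record Saturated (H : Graph n) : Set where
    field
      subgraph : H ⊑ G
      rich     : ∀ {a b} → Adj G a b → ¬ Adj H a b → r ≤ deg H a

  completionStep-⊑ : ∀ {H H′} → CompletionStep k G H H′ → H ⊑ H′
  completionStep-⊑ s e = Equivalence.from (CompletionStep.added s _ _) (inj₁ e)

  completionStep-saturated : ∀ {H H′} → CompletionStep k G H H′ → Saturated H → Saturated H′
  completionStep-saturated s sat = record
    { subgraph = λ e → [ subgraph , walkEdge⇒adj (Path.walk path) ]′ (Equivalence.to (added _ _) e)
    ; rich     = λ e ¬e → ≤-trans (rich e (¬e ∘ completionStep-⊑ s))
                                  (p⊆q⇒∣p∣≤∣q∣ (completionStep-⊑ s))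
    }
    where
    open Saturated sat
    open CompletionStep s

  shortest⇒≤ : ∀ {u v} (p : Path G u v) → IsShortest p → Within G m u v → pathLength p ≤ m
  shortest⇒≤ p short w = let q , q≤m = within⇒path w in ≤-trans (short q) q≤m

  -- Nothing exceeds an infinite d_G, and an infinite d_H excludes every walk. In the finite case a
  -- short walk in `H` contains a path that contradicts the violation.
  violating⇒far : ∀ {H u v} (p : Path G u v) → IsShortest p → Violating k G H u v →
                  ¬ Within H (k + pathLength p) u v
  violating⇒far {k} p short (⊤⁺ , _ , _ , _ , ()) w
  violating⇒far {k} p short ([ _ ] , ⊤⁺ , _ , ¬q , _) w = ¬q (proj₁ (within⇒path w))
  violating⇒far {k} {H} p short ([ _ ] , [ _ ] , (p₀ , _ , refl) , (q₀ , short₀ , refl) , lt) w =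
    <-irrefl refl (begin-strict
      pathLength q₀       ≤⟨ short₀ q ⟩
      pathLength q        ≤⟨ q≤ ⟩
      k + pathLength p    ≤⟨ +-monoʳ-≤ k (short p₀) ⟩
      k + pathLength p₀   ≡⟨ +-comm k _ ⟩
      pathLength p₀ + k   <⟨ [<]-injective lt ⟩
      pathLength q₀       ∎)
    where
    open ≤-Reasoning
    q = proj₁ (within⇒path w)
    q≤ = proj₂ (within⇒path w)

  -- The factor 6 is 2 · 3: a new step adds 2 to the degree sum, and r² times the number of new
  -- steps is at most 3 times the gain. Both sides are sums to avoid truncated subtraction.
  step-amortized : ∀ {H H′} → CompletionStep 6 G H H′ → Saturated H →
                   r * r * degSum H′ + 6 * total H ≤ r * r * degSum H + 6 * total H′
  step-amortized {H} {H′} s sat = begin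
    r * r * degSum H′ + 6 * total H
      ≤⟨ +-monoˡ-≤ _ (*-monoʳ-≤ (r * r) (degSum-step {G = G} {H} {H′} w added)) ⟩
    r * r * (degSum H + t * 2) + 6 * total H
      ≡⟨ rearrange₁ (r * r) (degSum H) t (total H) ⟩
    r * r * degSum H + (2 * (r * r * t) + 6 * total H)
      ≤⟨ +-monoʳ-≤ (r * r * degSum H) (+-monoˡ-≤ _ (*-monoʳ-≤ 2
           (newSteps≤gain route (violating⇒far path shortest violating) (shortest⇒≤ path shortest)))) ⟩
    r * r * degSum H + (2 * (3 * sum gain) + 6 * total H)
      ≡⟨ rearrange₂ (r * r * degSum H) (sum gain) (total H) ⟩
    r * r * degSum H + 6 * (sum gain + total H)
      ≡⟨ cong (λ z → r * r * degSum H + 6 * z) sum-gain ⟩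
    r * r * degSum H + 6 * total H′ ∎
    where
    open ≤-Reasoning
    open CompletionStep s
    open Gain (completionStep-⊑ s) (Saturated.subgraph (completionStep-saturated s sat)) (Saturated.rich sat)
    w = Path.walk path
    route = walk⇒route w (λ we → Equivalence.from (added _ _) (inj₂ we))
    t = newSteps route
    rearrange₁ : ∀ q a t p → q * (a + t * 2) + 6 * p ≡ q * a + (2 * (q * t) + 6 * p)
    rearrange₁ = solve-∀
    rearrange₂ : ∀ a g p → a + (2 * (3 * g) + 6 * p) ≡ a + 6 * (g + p)
    rearrange₂ = solve-∀

  run-amortized : ∀ {H H′} → Star (CompletionStep 6 G) H H′ → Saturated H →
                  r * r * degSum H′ + 6 * total H ≤ r * r * degSum H + 6 * total H′
  run-amortized ε sat = ≤-refl
  run-amortized {H} {H′} (_◅_ {j = K} s ss) sat =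
    -- Telescoping: the terms of the intermediate graph `K` are added on both sides and cancelled.
    +-cancelʳ-≤ (r * r * degSum K + 6 * total K) _ _ (begin
      (A′ + 6 * total H) + (A + 6 * total K)     ≡⟨ swap A′ (6 * total H) A (6 * total K) ⟩
      (A + 6 * total H) + (A′ + 6 * total K)     ≤⟨ +-mono-≤ (step-amortized s sat)
                                                      (run-amortized ss (completionStep-saturated s sat)) ⟩
      (A₀ + 6 * total K) + (A + 6 * total H′)    ≡⟨ swap′ A₀ (6 * total K) A (6 * total H′) ⟩
      (A₀ + 6 * total H′) + (A + 6 * total K)    ∎)
    where
    open ≤-Reasoning
    A₀ = r * r * degSum H
    A  = r * r * degSum K
    A′ = r * r * degSum H′
    swap : ∀ a b c d → (a + b) + (c + d) ≡ (c + b) + (a + d)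
    swap = solve-∀
    swap′ : ∀ a b c d → (a + b) + (c + d) ≡ (a + d) + (c + b)
    swap′ = solve-∀

-- The initial graph

module _ {n r : ℕ} {G H : Graph n} (init : Initial r G H) where

  open Initial init

  initial-saturated : Saturated {r = r} G H
  initial-saturated = record
    { subgraph = λ e → [ incident _ , Graph.sym G ∘ incident _ ]′ (Equivalence.to (adjacent _ _) e)
    ; rich     = rich
    }
    where
    rich : ∀ {a b} → Adj G a b → ¬ Adj H a b → r ≤ deg H a
    rich {a} e ¬e with r ≤? deg G a
    ... | yes r≤ = ≤-trans (≤-reflexive (sym (exactly a r≤)))
                           (p⊆q⇒∣p∣≤∣q∣ (λ y∈ → Equivalence.from (adjacent _ _) (inj₁ y∈)))
    -- At a vertex of degree below r all edges were chosen, so none can be missing.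
    ... | no r≰ = contradiction
      (Equivalence.from (adjacent _ _) (inj₁ (subst (_ ∈_) (sym (all a (≰⇒> r≰))) e))) ¬e

  ∣chosen∣≤ : ∀ x → ∣ chosen x ∣ ≤ r
  ∣chosen∣≤ x with r ≤? deg G x
  ... | yes r≤ = ≤-reflexive (exactly x r≤)
  ... | no  r≰ = ≤-trans (≤-reflexive (cong ∣_∣ (all x (≰⇒> r≰)))) (<⇒≤ (≰⇒> r≰))

  -- An adjacent pair (x , y) was chosen at x or at y, so the n r choices are each counted in both
  -- orders.
  initial-degSum : degSum H ≤ n * r + n * r
  initial-degSum = begin
    degSum H
      ≡⟨ degSum≡ H ⟩
    ∑[ x < n ] ∑[ y < n ] 𝟙 (y ∈? N H x)
      ≤⟨ sum-mono (λ x → sum-mono (λ y → pointwise x y)) ⟩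
    ∑[ x < n ] ∑[ y < n ] (c x y + c y x)
      ≡⟨ sum-cong-≗ (λ x → ∑-distrib-+ (c x) (λ y → c y x)) ⟩
    ∑[ x < n ] (sum (c x) + ∑[ y < n ] c y x)
      ≡⟨ ∑-distrib-+ (λ x → sum (c x)) (λ x → ∑[ y < n ] c y x) ⟩
    ∑[ x < n ] sum (c x) + ∑[ x < n ] ∑[ y < n ] c y x
      ≡⟨ cong (∑[ x < n ] sum (c x) +_) (∑-comm (λ x y → c y x)) ⟩
    ∑[ x < n ] sum (c x) + ∑[ x < n ] sum (c x)
      ≤⟨ +-mono-≤ row row ⟩
    n * r + n * r ∎
    where
    open ≤-Reasoning
    c : Fin n → Fin n → ℕ
    c x y = 𝟙 (y ∈? chosen x)
    row : ∑[ x < n ] sum (c x) ≤ n * r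
    row = sum≤n*c _ (λ x → ≤-trans (≤-reflexive (sym (∣p∣≡sum (chosen x)))) (∣chosen∣≤ x))
    pointwise : ∀ x y → 𝟙 (y ∈? N H x) ≤ c x y + c y x
    pointwise x y with y ∈? N H x
    ... | no  _ = z≤n
    ... | yes e with Equivalence.to (adjacent x y) e
    ...   | inj₁ y∈ = m≤n⇒m≤n+o _ (≤-reflexive (sym (𝟙-true (y ∈? chosen x) y∈)))
    ...   | inj₂ x∈ = m≤n⇒m≤o+n _ (≤-reflexive (sym (𝟙-true (x ∈? chosen y) x∈)))

-- The final bound

r²∣E∣≤32n² : {G H₀ H : Graph n} → r ^ 3 ≤ n → Initial r G H₀ →
             Star (CompletionStep 6 G) H₀ H → r * r * ∣E∣ H ≤ 32 * (n * n)
r²∣E∣≤32n² {n} {r} {G} {H₀} {H} r³≤n init run = begin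
  r * r * ∣E∣ H                                ≤⟨ *-monoʳ-≤ (r * r) (∣E∣≤degSum H) ⟩
  r * r * degSum H                             ≤⟨ m≤m+n _ _ ⟩
  r * r * degSum H + 6 * total H₀              ≤⟨ run-amortized G run (initial-saturated init) ⟩
  r * r * degSum H₀ + 6 * total H              ≤⟨ +-mono-≤ (*-monoʳ-≤ (r * r) (initial-degSum init))
                                                           (*-monoʳ-≤ 6 (total≤ H)) ⟩
  -- The initial edges contribute 2 n r³ ≤ 2 n², the potential 6 · 5 n².
  r * r * (n * r + n * r) + 6 * (n * (n * 5))  ≡⟨ rearrange r n ⟩
  2 * (n * r ^ 3) + 30 * (n * n)               ≤⟨ +-monoˡ-≤ _ (*-monoʳ-≤ 2 (*-monoʳ-≤ n r³≤n)) ⟩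
  2 * (n * n) + 30 * (n * n)                   ≡⟨ *-distribʳ-+ (n * n) 2 30 ⟨
  32 * (n * n)                                 ∎
  where
  open ≤-Reasoning
  open Potential G
  rearrange : ∀ r n → r * r * (n * r + n * r) + 6 * (n * (n * 5)) ≡ 2 * (n * (r * (r * (r * 1)))) + 30 * (n * n)
  rearrange = solve-∀

-- Cubing avoids the exponent 4/3. Since n ≤ (2r)³, multiplying e³ by n² gives at most (4 r² e)³ ≤
-- (4 k n²)³, and n² cancels.
cube-bound : ∀ k n r e → n < suc r ^ 3 → r * r * e ≤ k * (n * n) → 1 ≤ n →
             e ^ 3 ≤ (4 * k) ^ 3 * n ^ 4
-- With r = 0 the first hypothesis forces n = 0.
cube-bound k n zero e (s≤s z≤n) _ ()
cube-bound k n r@(suc _) e n<[1+r]³ r²e≤kn² 1≤n =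
  *-cancelʳ-≤ _ _ (n * n) {{>-nonZero (*-mono-≤ 1≤n 1≤n)}} (begin
    e ^ 3 * (n * n)                        ≤⟨ *-monoʳ-≤ (e ^ 3) (*-mono-≤ n≤[2r]³ n≤[2r]³) ⟩
    e ^ 3 * ((2 * r) ^ 3 * (2 * r) ^ 3)    ≡⟨ rearrange₁ e r ⟩
    (4 * (r * r * e)) ^ 3                  ≤⟨ ^-monoˡ-≤ 3 (*-monoʳ-≤ 4 r²e≤kn²) ⟩
    (4 * (k * (n * n))) ^ 3                ≡⟨ rearrange₂ k n ⟩
    (4 * k) ^ 3 * n ^ 4 * (n * n)          ∎)
  where
  open ≤-Reasoning
  n≤[2r]³ : n ≤ (2 * r) ^ 3
  -- Here 1 + r ≤ 2r because r ≥ 1.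
  n≤[2r]³ = ≤-trans (<⇒≤ n<[1+r]³) (^-monoˡ-≤ 3 (+-mono-≤ {1} {r} (s≤s z≤n) (m≤m+n r 0)))
  rearrange₁ : ∀ e r → e * (e * (e * 1)) * (2 * r * (2 * r * (2 * r * 1)) * (2 * r * (2 * r * (2 * r * 1))))
                     ≡ 4 * (r * r * e) * (4 * (r * r * e) * (4 * (r * r * e) * 1))
  rearrange₁ = solve-∀
  rearrange₂ : ∀ k n → 4 * (k * (n * n)) * (4 * (k * (n * n)) * (4 * (k * (n * n)) * 1))
                     ≡ 4 * k * (4 * k * (4 * k * 1)) * (n * (n * (n * (n * 1)))) * (n * n)
  rearrange₂ = solve-∀

theorem1 : ∃[ C ] (∀ (n : ℕ) (G H₀ H : Graph n) →
    Initial ⌊∛ n ⌋ G H₀ → Completion 6 G H₀ H →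
    ∣E∣ H ^ 3 ≤ C ^ 3 * n ^ 4)
-- The constant is 4 · 32.
theorem1 = 128 , bound
  where
  bound : ∀ n (G H₀ H : Graph n) → Initial ⌊∛ n ⌋ G H₀ → Completion 6 G H₀ H →
          ∣E∣ H ^ 3 ≤ 128 ^ 3 * n ^ 4
  bound zero      G H₀ H init run       = z≤n
  bound n@(suc _) G H₀ H init (run , _) =
    cube-bound 32 n ⌊∛ n ⌋ (∣E∣ H) (proj₂ (⌊∛⌋-spec n))
      (r²∣E∣≤32n² (proj₁ (⌊∛⌋-spec n)) init run) (s≤s z≤n)
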